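{- Let $u$ and $v$ be $\mathbf{a}\mathbf{b}$-monomials (words in the non-commuting letters $\mathbf{a},\mathbf{b}$, possibly the empty word $1$) of degree $p$ and $q$, respectively. Then the $\mathbf{a}\mathbf{b}$-polynomial $u\diamond v$ is given by $$u\diamond v=\sum_{P\in \Omega(p,q)} \operatorname{wt}_{u,v}(P),$$ where $\diamond$ is the diamond product on $\mathbb{Z}\langle\mathbf{a},\mathbf{b}\rangle$, $\Omega(p,q)$ is the set of lattice paths from $(0,0)$ to $(p,q)$ with steps $\mathbf{R}=(1,0)$, $\mathbf{U}=(0,1)$, $\mathbf{D}=(1,1)$ having no $\mathbf{U}$ step immediately followed by an $\mathbf{R}$ step, and $\operatorname{wt}_{u,v}$ is the weight function determined by labeling the horizontal axis by $u$ and the vertical axis by $v$.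
   Context: **Ring and coproduct.** $\mathbb{Z}\langle\mathbf{a},\mathbf{b}\rangle$ is the ring of polynomials in non-commuting variables $\mathbf{a},\mathbf{b}$, each of degree $1$. The coproduct $\Delta:\mathbb{Z}\langle\mathbf{a},\mathbf{b}\rangle\to\mathbb{Z}\langle\mathbf{a},\mathbf{b}\rangle\otimes\mathbb{Z}\langle\mathbf{a},\mathbf{b}\rangle$ is the linear map given on a monomial $u=u_1\cdots u_n$ (each $u_i\in\{\mathbf{a},\mathbf{b}\}$) by $$\Delta(u)=\sum_{i=1}^n u_1\cdots u_{i-1}\otimes u_{i+1}\cdots u_n,\qquad \Delta(1)=0.$$ Sweedler notation: $\Delta(u)=\sum_u u_{(1)}\otimes u_{(2)}$. **Diamond product.** $\diamond:\mathbb{Z}\langle\mathbf{a},\mathbf{b}\rangle\times\mathbb{Z}\langle\mathbf{a},\mathbf{b}\rangle\to\mathbb{Z}\langle\mathbf{a},\mathbf{b}\rangle$ is the bilinear operator (determined uniquely) satisfying, for all $\mathbf{a}\mathbf{b}$-polynomials $u,v$, $$u\diamond 1=u,$$ $$u\diamond (v\cdot \mathbf{a}) =(u\diamond v)\cdot \mathbf{a} + \sum_u (u_{(1)} \diamond v)\cdot \mathbf{a}\cdot\mathbf{b} \cdot u_{(2)},$$ $$u\diamond (v\cdot \mathbf{b}) = (u\diamond v)\cdot \mathbf{b} + \sum_u (u_{(1)} \diamond v)\cdot \mathbf{b}\cdot\mathbf{a} \cdot u_{(2)}.$$ **Lattice paths.** Lattice paths are words in the letters $\mathbf{R}=(1,0)$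 (right), $\mathbf{U}=(0,1)$ (up), $\mathbf{D}=(1,1)$ (diagonal), read from left to right as successive steps starting at $(0,0)$. $\Omega(p,q)$ is the set of such paths from $(0,0)$ to $(p,q)$ that do not contain $\mathbf{U}\mathbf{R}$ as a contiguous subword. **Labels and weight.** For $u=u_1\cdots u_p$ and $v=v_1\cdots v_q$, label the unit interval $[i-1,i]$ of the horizontal axis by $u_i$ and the unit interval $[j-1,j]$ of the vertical axis by $v_j$. A step is "above" the label $u_i$ if it goes from $x$-coordinate $i-1$ to $i$, and "to the right of" the label $v_j$ if it goes from $y$-coordinate $j-1$ to $j$. The weight $\operatorname{wt}_{u,v}(P)\in\mathbb{Z}\langle\mathbf{a},\mathbf{b}\rangle$ of a path $P$ is the product, in order along the path, of the weights of its steps, where: - an $\mathbf{R}$ step has weight $\mathbf{a}$ if it is above an $\mathbf{a}$ label, and $\mathbf{b}$ if it is above a $\mathbf{b}$ label; - a $\mathbf{U}$ step has weight $\mathbf{a}$ if it is to the right of an $\mathbf{a}$ label, and $\mathbf{b}$ if it is to the right of a $\mathbf{b}$ label; - a $\mathbf{D}$ step has weight $\mathbf{a}\cdot\mathbf{b}$ if it is to the right of an $\mathbf{a}$ label, and $\mathbf{b}\cdot\mathbf{a}$ if it is to the right of a $\mathbf{b}$ label. -}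

module Defs where

open import Data.Integer.Base as ℤ using (ℤ; 0ℤ; 1ℤ)
import Data.Integer.Properties as ℤₚ
open import Data.Integer.Tactic.RingSolver using (solve-∀)
open import Data.List.Base
  using (List; []; _∷_; _++_; [_]; map; concatMap; filter; length; take; drop; upTo; reverse)
import Data.List.Properties as Listₚ
open import Data.List.Instances using (List-≡-isDecEquivalence) public
open import Data.List.Membership.Propositional using (_∈_)
open import Data.List.Membership.Propositional.Properties
  using (∈-map⁺; ∈-map⁻; ∈-++⁺ˡ; ∈-++⁺ʳ; ∈-++⁻; ∈-filter⁺; ∈-filter⁻)
open import Data.List.Relation.Binary.Infix.Heterogeneous using (Infix)
open import Data.List.Relation.Binary.Infix.Heterogeneous.Properties using (infix?)
open import Data.List.Relation.Unary.All using ([])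
open import Data.List.Relation.Unary.AllPairs using ([]; _∷_)
open import Data.List.Relation.Unary.Any using (here; there)
open import Data.List.Relation.Unary.Unique.Propositional using (Unique)
open import Data.List.Relation.Unary.Unique.Propositional.Properties
  using () renaming (map⁺ to Unique-map⁺; ++⁺ to Unique-++⁺; filter⁺ to Unique-filter⁺)
open import Data.Nat.Base as ℕ using (ℕ; zero; suc; s≤s)
import Data.Nat.Properties as ℕₚ
open import Data.Product.Base using (_×_; _,_; proj₁; proj₂)
open import Data.Product.Instances using (Σ-≡-isDecEquivalence) public
open import Data.Sum.Base using (inj₁; inj₂)
open import Data.Vec.Base using (Vec; []; _∷_; toList)
open import Function.Base using (_∘_)
open import Function.Bundles using (_⇔_; mk⇔)
open import Relation.Binary.Bundles using (Setoid)
open import Relation.Binary.Definitions using (DecidableEquality)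
open import Relation.Binary.PropositionalEquality
  using (_≡_; _≢_; refl; sym; trans; cong; cong₂; module ≡-Reasoning)
open import Relation.Binary.PropositionalEquality.Properties using (isDecEquivalence)
open import Relation.Binary.Structures using (IsDecEquivalence)
open import Relation.Binary.TypeClasses using (_≟_)
import Relation.Binary.Reasoning.Setoid as SetoidReasoning
open import Relation.Nullary using (¬_; Dec; yes; no; contradiction)
open import Relation.Nullary.Decidable using (¬?)

DecEq : Set → Set
DecEq X = IsDecEquivalence {A = X} _≡_

-- An element of the free ℤ-module on X is written as a finite list of
-- terms c·x.  Repeated basis elements and zero coefficients are allowed;
-- the equality of the module is _≈_ below, not _≡_.
Free : Set → Set
Free X = List (ℤ × X)

private
  variable
    A X Y Z : Set

infixl 6 _+_
infixr 7 _•_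

⟨_⟩ : X → Free X
⟨ x ⟩ = (1ℤ , x) ∷ []

_+_ : Free X → Free X → Free X
_+_ = _++_

_•_ : ℤ → Free X → Free X
c • p = map (λ t → c ℤ.* proj₁ t , proj₂ t) p

infix 5 ∑ extend
∑ : List A → (A → Free X) → Free X
∑ as f = concatMap f as

syntax ∑ as (λ a → e) = ∑[ a ← as ] e

-- The value at p of the ℤ-linear map sending each basis element x to f x.
extend : Free X → (X → Free Y) → Free Y
extend p f = ∑ p (λ t → proj₁ t • f (proj₂ t))

syntax extend p (λ x → e) = extend[ x ← p ] e

term : ⦃ DecEq X ⦄ → X → ℤ × X → ℤ
term x (c , y) with y ≟ x
... | yes _ = c
... | no  _ = 0ℤ

coeff : ⦃ DecEq X ⦄ → Free X → X → ℤ
coeff []      x = 0ℤ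
coeff (t ∷ p) x = term x t ℤ.+ coeff p x

infix 4 _≈_
record _≈_ ⦃ _ : DecEq X ⦄ (p q : Free X) : Set where
  constructor mk≈
  field
    coeff-≡ : ∀ x → coeff p x ≡ coeff q x

open _≈_ public

record Linear ⦃ _ : DecEq X ⦄ ⦃ _ : DecEq Y ⦄ (F : Free X → Free Y) : Set where
  field
    resp-≈ : ∀ {p q} → p ≈ q → F p ≈ F q
    resp-+ : ∀ p q → F (p + q) ≈ F p + F q
    resp-• : ∀ c p → F (c • p) ≈ c • F p

open Linear public

record Bilinear ⦃ _ : DecEq X ⦄ ⦃ _ : DecEq Y ⦄ ⦃ _ : DecEq Z ⦄
                (B : Free X → Free Y → Free Z) : Set where
  field
    linearˡ : ∀ q → Linear (λ p → B p q)
    linearʳ : ∀ p → Linear (λ q → B p q)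

open Bilinear public

data Letter : Set where
  𝐚 𝐛 : Letter

_≟ᴸ_ : DecidableEquality Letter
𝐚 ≟ᴸ 𝐚 = yes refl
𝐚 ≟ᴸ 𝐛 = no λ ()
𝐛 ≟ᴸ 𝐚 = no λ ()
𝐛 ≟ᴸ 𝐛 = yes refl

instance
  Letter-≡-isDecEquivalence : DecEq Letter
  Letter-≡-isDecEquivalence = isDecEquivalence _≟ᴸ_

Word : Set
Word = List Letter

Poly : Set
Poly = Free Word

-- ℤ⟨𝐚,𝐛⟩ ⊗ ℤ⟨𝐚,𝐛⟩ is free on the pure tensors of words; (x , y) is x ⊗ y.
Poly⊗Poly : Set
Poly⊗Poly = Free (Word × Word)

𝟏 : Poly
𝟏 = ⟨ [] ⟩

var : Letter → Poly
var x = ⟨ [ x ] ⟩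

infixl 7 _·_
_·_ : Poly → Poly → Poly
p · q = extend[ x ← p ] extend[ y ← q ] ⟨ x ++ y ⟩

-- With the index i running from 0, u₁⋯uᵢ ⊗ uᵢ₊₂⋯uₙ.
Δʷ : Word → Poly⊗Poly
Δʷ u = ∑[ i ← upTo (length u) ] ⟨ take i u , drop (suc i) u ⟩

Δ : Poly → Poly⊗Poly
Δ p = extend p Δʷ

-- The Sweedler sum ∑ᵤ (u₍₁₎ ⋄ v)·m·u₍₂₎ is the linear extension of
-- x ⊗ y ↦ (x ⋄ v)·m·y, evaluated at Δ u.  Such an operator exists, see
-- diamond-isDiamondProduct; the equations determine it up to _≈_.
record IsDiamondProduct (_⋄_ : Poly → Poly → Poly) : Set where
  field
    bilinear : Bilinear _⋄_
    ⋄-𝟏 : ∀ u → u ⋄ 𝟏 ≈ u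
    ⋄-𝐚 : ∀ u v → u ⋄ (v · var 𝐚) ≈
          (u ⋄ v) · var 𝐚
          + (extend[ (u₁ , u₂) ← Δ u ] (⟨ u₁ ⟩ ⋄ v) · var 𝐚 · var 𝐛 · ⟨ u₂ ⟩)
    ⋄-𝐛 : ∀ u v → u ⋄ (v · var 𝐛) ≈
          (u ⋄ v) · var 𝐛
          + (extend[ (u₁ , u₂) ← Δ u ] (⟨ u₁ ⟩ ⋄ v) · var 𝐛 · var 𝐚 · ⟨ u₂ ⟩)

data Step : Set where
  𝐑 𝐔 𝐃 : Step

private
  variable
    p q : ℕ

-- Path p q consists of the paths with total displacement (p , q), read
-- from the first step on.
infixr 5 𝐑∷_ 𝐔∷_ 𝐃∷_
data Path : ℕ → ℕ → Set where
  []   : Path 0 0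
  𝐑∷_ : Path p q → Path (suc p) q
  𝐔∷_ : Path p q → Path p (suc q)
  𝐃∷_ : Path p q → Path (suc p) (suc q)

steps : Path p q → List Step
steps []      = []
steps (𝐑∷ P) = 𝐑 ∷ steps P
steps (𝐔∷ P) = 𝐔 ∷ steps P
steps (𝐃∷ P) = 𝐃 ∷ steps P

_≟ˢ_ : DecidableEquality Step
𝐑 ≟ˢ 𝐑 = yes refl
𝐑 ≟ˢ 𝐔 = no λ ()
𝐑 ≟ˢ 𝐃 = no λ ()
𝐔 ≟ˢ 𝐑 = no λ ()
𝐔 ≟ˢ 𝐔 = yes refl
𝐔 ≟ˢ 𝐃 = no λ ()
𝐃 ≟ˢ 𝐑 = no λ ()
𝐃 ≟ˢ 𝐔 = no λ ()
𝐃 ≟ˢ 𝐃 = yes refl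

Contains𝐔𝐑 : Path p q → Set
Contains𝐔𝐑 P = Infix _≡_ (𝐔 ∷ 𝐑 ∷ []) (steps P)

contains𝐔𝐑? : (P : Path p q) → Dec (Contains𝐔𝐑 P)
contains𝐔𝐑? P = infix? _≟ˢ_ (𝐔 ∷ 𝐑 ∷ []) (steps P)

paths : ∀ p q → List (Path p q)
paths zero    zero    = [] ∷ []
paths (suc p) zero    = map 𝐑∷_ (paths p zero)
paths zero    (suc q) = map 𝐔∷_ (paths zero q)
paths (suc p) (suc q) =
  map 𝐑∷_ (paths p (suc q)) ++ map 𝐔∷_ (paths (suc p) q) ++ map 𝐃∷_ (paths p q)

-- ∈-Ω and Ω-unique: this lists each path without 𝐔𝐑 exactly once.
Ω : ∀ p q → List (Path p q)
Ω p q = filter (λ P → ¬? (contains𝐔𝐑? P)) (paths p q)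

-- The arguments are the labels from the current point onwards, so the
-- first label of u is the one below the next 𝐑 or 𝐃 step, and the first
-- label of v is the one to the left of the next 𝐔 or 𝐃 step.
wtʷ : Vec Letter p → Vec Letter q → Path p q → Word
wtʷ []      []      []      = []
wtʷ (x ∷ u) v       (𝐑∷ P) = x ∷ wtʷ u v P
wtʷ u       (y ∷ v) (𝐔∷ P) = y ∷ wtʷ u v P
wtʷ (_ ∷ u) (𝐚 ∷ v) (𝐃∷ P) = 𝐚 ∷ 𝐛 ∷ wtʷ u v P
wtʷ (_ ∷ u) (𝐛 ∷ v) (𝐃∷ P) = 𝐛 ∷ 𝐚 ∷ wtʷ u v P

wt : Vec Letter p → Vec Letter q → Path p q → Poly
wt u v P = ⟨ wtʷ u v P ⟩

monomial : Vec Letter p → Poly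
monomial u = ⟨ toList u ⟩

∈-paths : (P : Path p q) → P ∈ paths p q
∈-paths []                            = here refl
∈-paths {q = zero}          (𝐑∷ P) = ∈-map⁺ 𝐑∷_ (∈-paths P)
∈-paths {q = suc _}         (𝐑∷ P) = ∈-++⁺ˡ (∈-map⁺ 𝐑∷_ (∈-paths P))
∈-paths {p = zero}          (𝐔∷ P) = ∈-map⁺ 𝐔∷_ (∈-paths P)
∈-paths {p = suc p} {suc q} (𝐔∷ P) =
  ∈-++⁺ʳ (map 𝐑∷_ (paths p (suc q))) (∈-++⁺ˡ (∈-map⁺ 𝐔∷_ (∈-paths P)))
∈-paths {suc p} {suc q}     (𝐃∷ P) =
  ∈-++⁺ʳ (map 𝐑∷_ (paths p (suc q)))
    (∈-++⁺ʳ (map 𝐔∷_ (paths (suc p) q)) (∈-map⁺ 𝐃∷_ (∈-paths P)))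

paths-unique : ∀ p q → Unique (paths p q)
paths-unique zero    zero    = [] ∷ []
paths-unique (suc p) zero    = Unique-map⁺ (λ where refl → refl) (paths-unique p zero)
paths-unique zero    (suc q) = Unique-map⁺ (λ where refl → refl) (paths-unique zero q)
paths-unique (suc p) (suc q) =
  Unique-++⁺ (Unique-map⁺ (λ where refl → refl) (paths-unique p (suc q)))
    (Unique-++⁺ (Unique-map⁺ (λ where refl → refl) (paths-unique (suc p) q))
      (Unique-map⁺ (λ where refl → refl) (paths-unique p q)) disjoint₂)
    disjoint₁
  where
  disjoint₂ : ∀ {P} → ¬ (P ∈ map 𝐔∷_ (paths (suc p) q) × P ∈ map 𝐃∷_ (paths p q))
  disjoint₂ (i , j) with ∈-map⁻ 𝐔∷_ i | ∈-map⁻ 𝐃∷_ j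
  ... | _ , _ , refl | _ , _ , ()

  disjoint₁ : ∀ {P} → ¬ (P ∈ map 𝐑∷_ (paths p (suc q)) ×
                         P ∈ map 𝐔∷_ (paths (suc p) q) ++ map 𝐃∷_ (paths p q))
  disjoint₁ (i , j) with ∈-map⁻ 𝐑∷_ i | ∈-++⁻ (map 𝐔∷_ (paths (suc p) q)) j
  ... | _ , _ , refl | inj₁ k with ∈-map⁻ 𝐔∷_ k
  ...   | _ , _ , ()
  disjoint₁ (i , j) | _ , _ , refl | inj₂ k with ∈-map⁻ 𝐃∷_ k
  ...   | _ , _ , ()

∈-Ω : (P : Path p q) → P ∈ Ω p q ⇔ (¬ Contains𝐔𝐑 P)
∈-Ω P = mk⇔ (λ i → proj₂ (∈-filter⁻ (λ P → ¬? (contains𝐔𝐑? P)) {xs = paths _ _} i))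
            (∈-filter⁺ (λ P → ¬? (contains𝐔𝐑? P)) (∈-paths P))

Ω-unique : ∀ p q → Unique (Ω p q)
Ω-unique p q = Unique-filter⁺ (λ P → ¬? (contains𝐔𝐑? P)) (paths-unique p q)

module _ ⦃ _ : DecEq X ⦄ where

  private
    variable
      f g h : Free X

  ≈-refl : f ≈ f
  ≈-refl = mk≈ λ x → refl

  ≈-reflexive : f ≡ g → f ≈ g
  ≈-reflexive refl = ≈-refl

  ≈-sym : f ≈ g → g ≈ f
  ≈-sym e = mk≈ λ x → sym (coeff-≡ e x)

  ≈-trans : f ≈ g → g ≈ h → f ≈ h
  ≈-trans e e′ = mk≈ λ x → trans (coeff-≡ e x) (coeff-≡ e′ x)

  coeff-+ : ∀ (f g : Free X) x → coeff (f + g) x ≡ coeff f x ℤ.+ coeff g x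
  coeff-+ []      g x = sym (ℤₚ.+-identityˡ _)
  coeff-+ (t ∷ f) g x =
    trans (cong (ℤ._+_ (term x t)) (coeff-+ f g x)) (sym (ℤₚ.+-assoc (term x t) _ _))

  term-* : ∀ c d (y x : X) → term x (c ℤ.* d , y) ≡ c ℤ.* term x (d , y)
  term-* c d y x with y ≟ x
  ... | yes _ = refl
  ... | no  _ = sym (ℤₚ.*-zeroʳ c)

  coeff-• : ∀ c (f : Free X) x → coeff (c • f) x ≡ c ℤ.* coeff f x
  coeff-• c []            x = sym (ℤₚ.*-zeroʳ c)
  coeff-• c ((d , y) ∷ f) x =
    trans (cong₂ ℤ._+_ (term-* c d y x) (coeff-• c f x)) (sym (ℤₚ.*-distribˡ-+ c _ _))

  +-cong : ∀ {f′ g′ : Free X} → f ≈ f′ → g ≈ g′ → f + g ≈ f′ + g′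
  +-cong {f} {g} {f′} {g′} e e′ = mk≈ λ x →
    trans (coeff-+ f g x)
      (trans (cong₂ ℤ._+_ (coeff-≡ e x) (coeff-≡ e′ x)) (sym (coeff-+ f′ g′ x)))

  •-cong : ∀ c → f ≈ g → c • f ≈ c • g
  •-cong {f} {g} c e = mk≈ λ x →
    trans (coeff-• c f x) (trans (cong (c ℤ.*_) (coeff-≡ e x)) (sym (coeff-• c g x)))

  +-interchange : ∀ (f f′ g g′ : Free X) → (f + f′) + (g + g′) ≈ (f + g) + (f′ + g′)
  +-interchange f f′ g g′ = mk≈ λ x →
    trans (four f f′ g g′ x)
      (trans (swap (coeff f x) (coeff f′ x) (coeff g x) (coeff g′ x)) (sym (four f g f′ g′ x)))
    where
    four : ∀ (a b c d : Free X) x → coeff ((a + b) + (c + d)) x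
         ≡ (coeff a x ℤ.+ coeff b x) ℤ.+ (coeff c x ℤ.+ coeff d x)
    four a b c d x =
      trans (coeff-+ (a + b) (c + d) x) (cong₂ ℤ._+_ (coeff-+ a b x) (coeff-+ c d x))
    swap : ∀ i j k l → (i ℤ.+ j) ℤ.+ (k ℤ.+ l) ≡ (i ℤ.+ k) ℤ.+ (j ℤ.+ l)
    swap = solve-∀

  •-distrib-+ : ∀ c (f g : Free X) → c • (f + g) ≈ c • f + c • g
  •-distrib-+ c f g = ≈-reflexive (Listₚ.map-++ _ f g)

  •-assoc : ∀ c d (f : Free X) → (c ℤ.* d) • f ≈ c • d • f
  •-assoc c d f = mk≈ λ x →
    trans (coeff-• (c ℤ.* d) f x)
      (trans (ℤₚ.*-assoc c d _)
        (sym (trans (coeff-• c (d • f) x) (cong (c ℤ.*_) (coeff-• d f x)))))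

  •-comm : ∀ c d (f : Free X) → c • d • f ≈ d • c • f
  •-comm c d f =
    ≈-trans (≈-sym (•-assoc c d f))
      (≈-trans (≈-reflexive (cong (_• f) (ℤₚ.*-comm c d))) (•-assoc d c f))

  1•-+[] : ∀ (f : Free X) → 1ℤ • f + [] ≈ f
  1•-+[] f = mk≈ λ x →
    trans (coeff-+ (1ℤ • f) [] x)
      (trans (ℤₚ.+-identityʳ _) (trans (coeff-• 1ℤ f x) (ℤₚ.*-identityˡ _)))

≈-setoid : (X : Set) ⦃ _ : DecEq X ⦄ → Setoid _ _
≈-setoid X = record
  { Carrier = Free X
  ; _≈_ = _≈_
  ; isEquivalence = record { refl = ≈-refl ; sym = ≈-sym ; trans = ≈-trans }
  }

-- Linear functionals respect _≈_: a list of terms with all coefficients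
-- zero evaluates to zero, by removing one basis element at a time.
eval : (X → ℤ) → Free X → ℤ
eval h []            = 0ℤ
eval h ((c , x) ∷ f) = c ℤ.* h x ℤ.+ eval h f

eval-+ : ∀ (h : X → ℤ) f g → eval h (f + g) ≡ eval h f ℤ.+ eval h g
eval-+ h []            g = sym (ℤₚ.+-identityˡ _)
eval-+ h ((c , x) ∷ f) g =
  trans (cong (ℤ._+_ (c ℤ.* h x)) (eval-+ h f g)) (sym (ℤₚ.+-assoc (c ℤ.* h x) _ _))

eval-• : ∀ (h : X → ℤ) c f → eval h (c • f) ≡ c ℤ.* eval h f
eval-• h c []            = sym (ℤₚ.*-zeroʳ c)
eval-• h c ((d , x) ∷ f) =
  trans (cong₂ ℤ._+_ (ℤₚ.*-assoc c d (h x)) (eval-• h c f)) (sym (ℤₚ.*-distribˡ-+ c _ _))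

module _ ⦃ _ : DecEq X ⦄ where

  remove : X → Free X → Free X
  remove x []            = []
  remove x ((c , y) ∷ f) with y ≟ x
  ... | yes _ = remove x f
  ... | no  _ = (c , y) ∷ remove x f

  length-remove : ∀ x (f : Free X) → length (remove x f) ℕ.≤ length f
  length-remove x []            = ℕ.z≤n
  length-remove x ((c , y) ∷ f) with y ≟ x
  ... | yes _ = ℕₚ.m≤n⇒m≤1+n (length-remove x f)
  ... | no  _ = s≤s (length-remove x f)

  length-remove-∷ : ∀ c x (f : Free X) → length (remove x ((c , x) ∷ f)) ℕ.≤ length f
  length-remove-∷ c x f with x ≟ x
  ... | yes _  = length-remove x f
  ... | no x≢x = contradiction refl x≢x

  coeff-remove-≡ : ∀ x (f : Free X) → coeff (remove x f) x ≡ 0ℤ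
  coeff-remove-≡ x []            = refl
  coeff-remove-≡ x ((c , y) ∷ f) with y ≟ x in eq
  ... | yes _ = coeff-remove-≡ x f
  ... | no  _ rewrite eq = trans (ℤₚ.+-identityˡ _) (coeff-remove-≡ x f)

  coeff-remove-≢ : ∀ x (f : Free X) {z} → x ≢ z → coeff (remove x f) z ≡ coeff f z
  coeff-remove-≢ x []            x≢z = refl
  coeff-remove-≢ x ((c , y) ∷ f) {z} x≢z with y ≟ x
  ... | no _     = cong (ℤ._+_ (term z (c , y))) (coeff-remove-≢ x f x≢z)
  ... | yes refl with y ≟ z
  ...   | yes y≡z = contradiction y≡z x≢z
  ...   | no  _   = trans (coeff-remove-≢ x f x≢z) (sym (ℤₚ.+-identityˡ _))

  eval-remove : ∀ h x (f : Free X) → eval h f ≡ coeff f x ℤ.* h x ℤ.+ eval h (remove x f)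
  eval-remove h x []            = refl
  eval-remove h x ((c , y) ∷ f) with y ≟ x
  ... | yes refl = trans (cong (ℤ._+_ (c ℤ.* h y)) (eval-remove h y f)) (step c (coeff f y) (h y) _)
    where
    step : ∀ c k a r → c ℤ.* a ℤ.+ (k ℤ.* a ℤ.+ r) ≡ (c ℤ.+ k) ℤ.* a ℤ.+ r
    step = solve-∀
  ... | no _ = trans (cong (ℤ._+_ (c ℤ.* h y)) (eval-remove h x f))
      (step (c ℤ.* h y) (coeff f x) (h x) _)
    where
    step : ∀ b k a r → b ℤ.+ (k ℤ.* a ℤ.+ r) ≡ (0ℤ ℤ.+ k) ℤ.* a ℤ.+ (b ℤ.+ r)
    step = solve-∀

  eval-zero : ∀ h n (f : Free X) → length f ℕ.≤ n → (∀ x → coeff f x ≡ 0ℤ) → eval h f ≡ 0ℤ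
  eval-zero h n       []              _         _ = refl
  eval-zero h (suc n) f@((c , x) ∷ r) (s≤s r≤n) z = begin
    eval h f                                  ≡⟨ eval-remove h x f ⟩
    coeff f x ℤ.* h x ℤ.+ eval h (remove x f) ≡⟨ cong₂ (λ i j → i ℤ.* h x ℤ.+ j) (z x) rest ⟩
    0ℤ                                        ∎
    where
    open ≡-Reasoning
    z′ : ∀ y → coeff (remove x f) y ≡ 0ℤ
    z′ y with x ≟ y
    ... | yes refl = coeff-remove-≡ x f
    ... | no  x≢y  = trans (coeff-remove-≢ x f x≢y) (z y)
    rest : eval h (remove x f) ≡ 0ℤ
    rest = eval-zero h n (remove x f) (ℕₚ.≤-trans (length-remove-∷ c x r) r≤n) z′

  eval-cong : ∀ h {f g : Free X} → f ≈ g → eval h f ≡ eval h g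
  eval-cong h {f} {g} e = ℤₚ.i-j≡0⇒i≡j (eval h f) (eval h g) (begin
    eval h f ℤ.- eval h g             ≡⟨ cong (ℤ._+_ (eval h f)) (neg (eval h g)) ⟩
    eval h f ℤ.+ ℤ.-1ℤ ℤ.* eval h g   ≡⟨ cong (ℤ._+_ (eval h f)) (eval-• h ℤ.-1ℤ g) ⟨
    eval h f ℤ.+ eval h (ℤ.-1ℤ • g)   ≡⟨ eval-+ h f (ℤ.-1ℤ • g) ⟨
    eval h (f + ℤ.-1ℤ • g)            ≡⟨ eval-zero h _ (f + ℤ.-1ℤ • g) ℕₚ.≤-refl zeros ⟩
    0ℤ                                ∎)
    where
    open ≡-Reasoning
    neg : ∀ i → ℤ.- i ≡ ℤ.-1ℤ ℤ.* i
    neg i = sym (ℤₚ.-1*i≡-i i)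
    zeros : ∀ x → coeff (f + ℤ.-1ℤ • g) x ≡ 0ℤ
    zeros x = begin
      coeff (f + ℤ.-1ℤ • g) x             ≡⟨ coeff-+ f (ℤ.-1ℤ • g) x ⟩
      coeff f x ℤ.+ coeff (ℤ.-1ℤ • g) x   ≡⟨ cong₂ ℤ._+_ (coeff-≡ e x) (coeff-• ℤ.-1ℤ g x) ⟩
      coeff g x ℤ.+ ℤ.-1ℤ ℤ.* coeff g x   ≡⟨ cong (ℤ._+_ (coeff g x)) (neg (coeff g x)) ⟨
      coeff g x ℤ.- coeff g x             ≡⟨ ℤₚ.+-inverseʳ (coeff g x) ⟩
      0ℤ                                  ∎

module _ ⦃ _ : DecEq X ⦄ ⦃ _ : DecEq Y ⦄ where

  coeff-extend : ∀ (φ : X → Free Y) f y →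
                 coeff (extend f φ) y ≡ eval (λ x → coeff (φ x) y) f
  coeff-extend φ []            y = refl
  coeff-extend φ ((c , x) ∷ f) y =
    trans (coeff-+ (c • φ x) (extend f φ) y)
      (cong₂ ℤ._+_ (coeff-• c (φ x) y) (coeff-extend φ f y))

  extend-cong : ∀ {φ ψ : X → Free Y} f → (∀ x → φ x ≈ ψ x) → extend f φ ≈ extend f ψ
  extend-cong []            e = ≈-refl
  extend-cong ((c , x) ∷ f) e = +-cong (•-cong c (e x)) (extend-cong f e)

  extend-linear : ∀ (φ : X → Free Y) → Linear (λ f → extend f φ)
  extend-linear φ .resp-≈ {f} {g} e = mk≈ λ y →
    trans (coeff-extend φ f y) (trans (eval-cong _ e) (sym (coeff-extend φ g y)))
  extend-linear φ .resp-+ f g = ≈-reflexive (Listₚ.concatMap-++ _ f g)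
  extend-linear φ .resp-• c [] = ≈-refl
  extend-linear φ .resp-• c ((d , x) ∷ f) =
    ≈-trans (+-cong (•-assoc c d (φ x)) (extend-linear φ .resp-• c f))
      (≈-sym (•-distrib-+ c (d • φ x) (extend f φ)))

  extend-⟨⟩ : ∀ (φ : X → Free Y) x → extend ⟨ x ⟩ φ ≈ φ x
  extend-⟨⟩ φ x = 1•-+[] (φ x)

  +-linear : ∀ {F G : Free X → Free Y} → Linear F → Linear G → Linear (λ f → F f + G f)
  +-linear l m .resp-≈ e = +-cong (l .resp-≈ e) (m .resp-≈ e)
  +-linear {F} {G} l m .resp-+ f g =
    ≈-trans (+-cong (l .resp-+ f g) (m .resp-+ f g)) (+-interchange (F f) (F g) (G f) (G g))
  +-linear {F} {G} l m .resp-• c f =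
    ≈-trans (+-cong (l .resp-• c f) (m .resp-• c f)) (≈-sym (•-distrib-+ c (F f) (G f)))

  0-linear : Linear {X} {Y} (λ _ → [])
  0-linear .resp-≈ _ = ≈-refl
  0-linear .resp-+ _ _ = ≈-refl
  0-linear .resp-• _ _ = ≈-refl

  •-linear : ∀ {F : Free X → Free Y} c → Linear F → Linear (λ f → c • F f)
  •-linear c l .resp-≈ e = •-cong c (l .resp-≈ e)
  •-linear {F} c l .resp-+ f g =
    ≈-trans (•-cong c (l .resp-+ f g)) (•-distrib-+ c (F f) (F g))
  •-linear {F} c l .resp-• d f =
    ≈-trans (•-cong c (l .resp-• d f)) (•-comm c d (F f))

  extend-linearʳ : ∀ {Φ : Z → Free X → Free Y} (r : Free Z) → (∀ z → Linear (Φ z)) →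
                   Linear (λ f → extend r (λ z → Φ z f))
  extend-linearʳ []            l = 0-linear
  extend-linearʳ ((c , z) ∷ r) l = +-linear (•-linear c (l z)) (extend-linearʳ r l)

  linear-0 : ∀ {F : Free X → Free Y} → Linear F → F [] ≈ []
  linear-0 {F} l = mk≈ λ y →
    trans (coeff-≡ (l .resp-• 0ℤ []) y) (coeff-• 0ℤ (F []) y)

  linear-unique : ∀ {F G : Free X → Free Y} → Linear F → Linear G →
                  (∀ x → F ⟨ x ⟩ ≈ G ⟨ x ⟩) → ∀ f → F f ≈ G f
  linear-unique l m e [] = ≈-trans (linear-0 l) (≈-sym (linear-0 m))
  linear-unique {F} {G} l m e ((c , x) ∷ f) =
    ≈-trans (split l) (≈-trans (+-cong (•-cong c (e x)) (linear-unique l m e f))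
      (≈-sym (split m)))
    where
    split : ∀ {H} → Linear H → H ((c , x) ∷ f) ≈ c • H ⟨ x ⟩ + H f
    split {H} k =
      ≈-trans (≈-reflexive (cong (λ d → H ((d , x) ∷ f)) (sym (ℤₚ.*-identityʳ c))))
        (≈-trans (k .resp-+ (c • ⟨ x ⟩) f) (+-cong (k .resp-• c ⟨ x ⟩) ≈-refl))

∘-linear : ⦃ _ : DecEq X ⦄ ⦃ _ : DecEq Y ⦄ ⦃ _ : DecEq Z ⦄
           {F : Free Y → Free Z} {G : Free X → Free Y} →
           Linear F → Linear G → Linear (λ f → F (G f))
∘-linear l m .resp-≈ e = l .resp-≈ (m .resp-≈ e)
∘-linear l m .resp-+ f g = ≈-trans (l .resp-≈ (m .resp-+ f g)) (l .resp-+ _ _)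
∘-linear l m .resp-• c f = ≈-trans (l .resp-≈ (m .resp-• c f)) (l .resp-• c _)

extend₂-bilinear : ⦃ _ : DecEq X ⦄ ⦃ _ : DecEq Y ⦄ ⦃ _ : DecEq Z ⦄ (φ : X → Y → Free Z) →
                   Bilinear (λ f g → extend[ x ← f ] extend[ y ← g ] φ x y)
extend₂-bilinear φ .linearˡ g = extend-linear (λ x → extend g (φ x))
extend₂-bilinear φ .linearʳ f = extend-linearʳ f (λ x → extend-linear (φ x))

extend₂-⟨⟩ : ⦃ _ : DecEq X ⦄ ⦃ _ : DecEq Y ⦄ ⦃ _ : DecEq Z ⦄ (φ : X → Y → Free Z) → ∀ x y →
             (extend[ x′ ← ⟨ x ⟩ ] extend[ y′ ← ⟨ y ⟩ ] φ x′ y′) ≈ φ x y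
extend₂-⟨⟩ φ x y = ≈-trans (extend-⟨⟩ (λ x′ → extend ⟨ y ⟩ (φ x′)) x) (extend-⟨⟩ (φ x) y)

·-bilinear : Bilinear _·_
·-bilinear = extend₂-bilinear (λ x y → ⟨ x ++ y ⟩)

⟨⟩-· : ∀ x y → ⟨ x ⟩ · ⟨ y ⟩ ≈ ⟨ x ++ y ⟩
⟨⟩-· = extend₂-⟨⟩ (λ x y → ⟨ x ++ y ⟩)

bar : Letter → Letter
bar 𝐚 = 𝐛
bar 𝐛 = 𝐚

-- The second word is read from right to left.
diamondʳ : Word → Word → Poly
diamondʳ u []      = ⟨ u ⟩
diamondʳ u (x ∷ v) =
  diamondʳ u v · var x
  + (extend[ (u₁ , u₂) ← Δʷ u ] diamondʳ u₁ v · var x · var (bar x) · ⟨ u₂ ⟩)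

diamond : Poly → Poly → Poly
diamond f g = extend[ u ← f ] extend[ v ← g ] diamondʳ u (reverse v)

diamond-bilinear : Bilinear diamond
diamond-bilinear = extend₂-bilinear (λ u v → diamondʳ u (reverse v))

diamond-⟨⟩ : ∀ u v → diamond ⟨ u ⟩ ⟨ v ⟩ ≈ diamondʳ u (reverse v)
diamond-⟨⟩ = extend₂-⟨⟩ (λ u v → diamondʳ u (reverse v))

diamond-𝟏 : ∀ f → diamond f 𝟏 ≈ f
diamond-𝟏 = linear-unique (diamond-bilinear .linearˡ 𝟏)
  (record { resp-≈ = λ e → e ; resp-+ = λ _ _ → ≈-refl ; resp-• = λ _ _ → ≈-refl })
  (λ u → diamond-⟨⟩ u [])

private
  module _ (x : Letter) where

    tail : Poly → Word → Poly
    tail f u₂ = f · var x · var (bar x) · ⟨ u₂ ⟩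

    tail-linear : ∀ u₂ → Linear (λ f → tail f u₂)
    tail-linear u₂ = ∘-linear (·-bilinear .linearˡ ⟨ u₂ ⟩)
      (∘-linear (·-bilinear .linearˡ (var (bar x))) (·-bilinear .linearˡ (var x)))

    lhs rhs : Poly → Poly → Poly
    lhs f g = diamond f (g · var x)
    rhs f g = diamond f g · var x
            + (extend[ (u₁ , u₂) ← Δ f ] tail (diamond ⟨ u₁ ⟩ g) u₂)

    lhs-bilinear : Bilinear lhs
    lhs-bilinear .linearˡ g = diamond-bilinear .linearˡ (g · var x)
    lhs-bilinear .linearʳ f =
      ∘-linear (diamond-bilinear .linearʳ f) (·-bilinear .linearˡ (var x))

    rhs-bilinear : Bilinear rhs
    rhs-bilinear .linearˡ g = +-linear
      (∘-linear (·-bilinear .linearˡ (var x)) (diamond-bilinear .linearˡ g))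
      (∘-linear (extend-linear (λ (u₁ , u₂) → tail (diamond ⟨ u₁ ⟩ g) u₂)) (extend-linear Δʷ))
    rhs-bilinear .linearʳ f = +-linear
      (∘-linear (·-bilinear .linearˡ (var x)) (diamond-bilinear .linearʳ f))
      (extend-linearʳ (Δ f) λ (u₁ , u₂) →
        ∘-linear (tail-linear u₂) (diamond-bilinear .linearʳ ⟨ u₁ ⟩))

    lhs≈rhs-⟨⟩ : ∀ u v → lhs ⟨ u ⟩ ⟨ v ⟩ ≈ rhs ⟨ u ⟩ ⟨ v ⟩
    lhs≈rhs-⟨⟩ u v = begin
      diamond ⟨ u ⟩ (⟨ v ⟩ · var x)
        ≈⟨ diamond-bilinear .linearʳ ⟨ u ⟩ .resp-≈ (⟨⟩-· v [ x ]) ⟩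
      diamond ⟨ u ⟩ ⟨ v ++ [ x ] ⟩
        ≈⟨ diamond-⟨⟩ u (v ++ [ x ]) ⟩
      diamondʳ u (reverse (v ++ [ x ]))
        ≡⟨ cong (diamondʳ u) (Listₚ.reverse-++ v [ x ]) ⟩
      diamondʳ u (reverse v) · var x
      + (extend[ (u₁ , u₂) ← Δʷ u ] tail (diamondʳ u₁ (reverse v)) u₂)
        ≈⟨ +-cong (·-bilinear .linearˡ (var x) .resp-≈ (diamond-⟨⟩ u v))
             (extend-cong (Δʷ u) λ (u₁ , u₂) → tail-linear u₂ .resp-≈ (diamond-⟨⟩ u₁ v)) ⟨
      diamond ⟨ u ⟩ ⟨ v ⟩ · var x
      + (extend[ (u₁ , u₂) ← Δʷ u ] tail (diamond ⟨ u₁ ⟩ ⟨ v ⟩) u₂)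
        ≈⟨ +-cong ≈-refl (extend-linear (λ (u₁ , u₂) → tail (diamond ⟨ u₁ ⟩ ⟨ v ⟩) u₂)
             .resp-≈ (extend-⟨⟩ Δʷ u)) ⟨
      rhs ⟨ u ⟩ ⟨ v ⟩ ∎
      where open SetoidReasoning (≈-setoid Word)

    diamond-· : ∀ f g → lhs f g ≈ rhs f g
    diamond-· f g = linear-unique (lhs-bilinear .linearˡ g) (rhs-bilinear .linearˡ g)
      (λ u → linear-unique (lhs-bilinear .linearʳ ⟨ u ⟩) (rhs-bilinear .linearʳ ⟨ u ⟩)
        (lhs≈rhs-⟨⟩ u) g) f

diamond-isDiamondProduct : IsDiamondProduct diamond
diamond-isDiamondProduct = record
  { bilinear = diamond-bilinear
  ; ⋄-𝟏 = diamond-𝟏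
  ; ⋄-𝐚 = diamond-· 𝐚
  ; ⋄-𝐛 = diamond-· 𝐛
  }

-- Both sides are sums of words with coefficient 1, so the identity is one
-- between multisets of words, represented by lists up to permutation.  The
-- equations defining u ⋄ v remove the last letter of v, whereas a path is
-- read from its first step.  Let words v u be the weights of the 𝐔𝐑-free
-- paths, and non𝐑Words v u those of the paths which moreover do not start
-- with 𝐑.  Then words v arises from non𝐑Words v by prepending 𝐑 steps
-- (accumulate), and non𝐑Words (y ∷ v) by prepending a 𝐔 step to non𝐑Words v
-- or a 𝐃 step to words v (shift).  Adding the last letter y is the operator
-- F ↦ (u ↦ F u · y + ∑ᵤ F u₍₁₎ · y · bar y · u₍₂₎) (append).  It commutes with
-- all these operations on the front, hence words satisfies the defining
-- equations of the diamond product.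

{-# OPTIONS --safe #-}
module Submission where

open import Algebra.Bundles using (CommutativeMonoid)
import Algebra.Properties.CommutativeSemigroup as CommutativeSemigroupProperties
open import Data.Bool.Base using (true; false)
open import Data.Integer.Base as ℤ using (1ℤ)
import Data.Integer.Properties as ℤₚ
open import Data.List.Base
  using (List; []; _∷_; _++_; _∷ʳ_; [_]; map; concatMap; filter; length; take; drop; applyUpTo; upTo)
open import Data.List.Properties
  using (++-assoc; ++-identityʳ; concatMap-cong; concatMap-map; filter-++;
         map-++; map-applyUpTo; map-concatMap; map-cong; map-upTo; map-∘)
open import Data.List.Relation.Binary.Permutation.Propositional
  using (_↭_; prep; swap; ↭-reflexive; ↭-sym; module PermutationReasoning)
  renaming (refl to ↭-refl; trans to ↭-trans)
open import Data.List.Relation.Binary.Permutation.Propositional.Properties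
  using (++⁺; ++⁺ˡ; ++⁺ʳ; map⁺; ++-commutativeMonoid)
open import Data.List.Reverse using (Reverse; reverseView; []; _∶_∶ʳ_)
open import Data.Nat.Base using (ℕ; suc)
open import Data.Product.Base using (_×_; _,_; map₁)
open import Data.Vec.Base using (Vec; []; _∷_; toList)
open import Function.Base using (_∘_)
open import Level using (0ℓ)
open import Relation.Binary.PropositionalEquality
  using (_≡_; refl; sym; trans; cong; cong₂; module ≡-Reasoning)
import Relation.Binary.Reasoning.Setoid as SetoidReasoning
open import Relation.Nullary.Decidable using (does; ¬?)
open import Relation.Nullary.Negation.Core using (¬_)
open import Relation.Unary using (Pred; Decidable)
open import Defs

private
  variable
    A B C D : Set
    p q : ℕ

-- Rearranging and filtering lists.

++-interchange : (ws xs ys zs : List A) → (ws ++ xs) ++ (ys ++ zs) ↭ (ws ++ ys) ++ (xs ++ zs)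
++-interchange = CommutativeSemigroupProperties.interchange
  (CommutativeMonoid.commutativeSemigroup ++-commutativeMonoid)

concatMap-⊕ : (f g : A → List B) (xs : List A) →
              concatMap (λ x → f x ++ g x) xs ↭ concatMap f xs ++ concatMap g xs
concatMap-⊕ f g []       = ↭-refl
concatMap-⊕ f g (x ∷ xs) = ↭-trans (++⁺ˡ (f x ++ g x) (concatMap-⊕ f g xs))
  (++-interchange (f x) (g x) (concatMap f xs) (concatMap g xs))

-- Treats one kind of first step: `f` prepends it, `h` weighs the remaining path and `k` prepends
-- the weight of the step. Filtering inspects only `does`, so the two predicates need not have the
-- same proofs.
map-filter-map : {P : Pred B 0ℓ} {Q : Pred A 0ℓ} (P? : Decidable P) (Q? : Decidable Q)
                 {f : A → B} {g : B → C} {h : A → D} {k : D → C} →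
                 (∀ x → g (f x) ≡ k (h x)) → (∀ x → does (P? (f x)) ≡ does (Q? x)) →
                 ∀ xs → map g (filter P? (map f xs)) ≡ map k (map h (filter Q? xs))
map-filter-map P? Q? gf≡kh eq []       = refl
map-filter-map P? Q? {f = f} gf≡kh eq (x ∷ xs)
  with does (P? (f x)) | does (Q? x) | eq x
... | true  | _ | refl = cong₂ _∷_ (gf≡kh x) (map-filter-map P? Q? gf≡kh eq xs)
... | false | _ | refl = map-filter-map P? Q? gf≡kh eq xs

filter-map-none : {P : Pred B 0ℓ} (P? : Decidable P) {f : A → B} →
                  (∀ x → does (P? (f x)) ≡ false) → ∀ xs → filter P? (map f xs) ≡ []
filter-map-none P? eq []       = refl
filter-map-none P? {f} eq (x ∷ xs) rewrite eq x = filter-map-none P? eq xs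

-- Path weights by recursion on the first step.

emptyOnly : Word → List Word
emptyOnly []      = [ [] ]
emptyOnly (_ ∷ _) = []

-- For a `𝐃` step the letter dropped is the label below it, which does not enter its weight; the
-- empty word leaves no room for such a step.
shift : (Word → Word) → (Word → List Word) → Word → List Word
shift f F []      = []
shift f F (_ ∷ u) = map f (F u)

accumulate : (Word → List Word) → Word → List Word
accumulate F []      = F []
accumulate F (x ∷ u) = map (x ∷_) (accumulate F u) ++ F (x ∷ u)

accumulate-cong : ∀ {F G} → (∀ u → F u ↭ G u) → ∀ u → accumulate F u ↭ accumulate G u
accumulate-cong F↭G []      = F↭G []
accumulate-cong F↭G (x ∷ u) = ++⁺ (map⁺ (x ∷_) (accumulate-cong F↭G u)) (F↭G (x ∷ u))

shift-cong : ∀ f {F G} → (∀ u → F u ↭ G u) → ∀ u → shift f F u ↭ shift f G u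
shift-cong f F↭G []      = ↭-refl
shift-cong f F↭G (_ ∷ u) = map⁺ f (F↭G u)

non𝐑Words : Word → Word → List Word
-- Without labels on the vertical axis only `𝐑` steps are possible, so a path not starting with `𝐑`
-- is empty.
non𝐑Words []      u = emptyOnly u
non𝐑Words (y ∷ v) u =
  map (y ∷_) (non𝐑Words v u) ++ shift (λ w → y ∷ bar y ∷ w) (accumulate (non𝐑Words v)) u

words : Word → Word → List Word
words v = accumulate (non𝐑Words v)

words-[] : ∀ u → words [] u ≡ [ u ]
words-[] []      = refl
words-[] (x ∷ u) = trans (++-identityʳ _) (cong (map (x ∷_)) (words-[] u))

-- The terms of `Δʷ`, by recursion on the word instead of on the index: the first letter is either
-- the deleted one or stays in the left factor.
splits : Word → List (Word × Word)
splits []      = []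
splits (x ∷ u) = ([] , u) ∷ map (map₁ (x ∷_)) (splits u)

splits≡applyUpTo : ∀ u → splits u ≡ applyUpTo (λ i → take i u , drop (suc i) u) (length u)
splits≡applyUpTo []      = refl
splits≡applyUpTo (x ∷ u) = cong (([] , u) ∷_)
  (trans (cong (map (map₁ (x ∷_))) (splits≡applyUpTo u)) (map-applyUpTo _ _ (length u)))

-- Adding a last letter commutes with the operations on the front.

module _ (y : Letter) where

  joined : (Word → List Word) → Word × Word → List Word
  joined F (u₁ , u₂) = map (_++ y ∷ bar y ∷ u₂) (F u₁)

  append : (Word → List Word) → Word → List Word
  append F u = map (_∷ʳ y) (F u) ++ concatMap (joined F) (splits u)

  -- Only up to order, since along `splits u` the contributions of `F` and `G` alternate.
  append-⊕ : ∀ F G u → append (λ u → F u ++ G u) u ↭ append F u ++ append G u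
  append-⊕ F G u = begin
    map (_∷ʳ y) (F u ++ G u) ++ concatMap (joined (λ u → F u ++ G u)) (splits u)
      ≡⟨ cong₂ _++_ (map-++ _ (F u) (G u))
           (concatMap-cong (λ (u₁ , _) → map-++ _ (F u₁) (G u₁)) (splits u)) ⟩
    (map (_∷ʳ y) (F u) ++ map (_∷ʳ y) (G u))
      ++ concatMap (λ s → joined F s ++ joined G s) (splits u)
      ↭⟨ ++⁺ˡ _ (concatMap-⊕ (joined F) (joined G) (splits u)) ⟩
    (map (_∷ʳ y) (F u) ++ map (_∷ʳ y) (G u))
      ++ (concatMap (joined F) (splits u) ++ concatMap (joined G) (splits u))
      ↭⟨ ++-interchange (map (_∷ʳ y) (F u)) _ _ _ ⟩
    append F u ++ append G u ∎
    where open PermutationReasoning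

  module _ {f : Word → Word} (f-++ : ∀ w t → f w ++ t ≡ f (w ++ t)) where

    map-++ʳ-comm : ∀ t ws → map (_++ t) (map f ws) ≡ map f (map (_++ t) ws)
    map-++ʳ-comm t ws =
      trans (sym (map-∘ ws)) (trans (map-cong (λ w → f-++ w t) ws) (map-∘ ws))

    -- `append` extends words on the right, whereas `f` acts on their front.
    append-map : ∀ F u → append (map f ∘ F) u ≡ map f (append F u)
    append-map F u = begin
      map (_∷ʳ y) (map f (F u)) ++ concatMap (joined (map f ∘ F)) (splits u)
        ≡⟨ cong₂ _++_ (map-++ʳ-comm [ y ] (F u))
             (concatMap-cong (λ (u₁ , u₂) → map-++ʳ-comm (y ∷ bar y ∷ u₂) (F u₁)) (splits u)) ⟩
      map f (map (_∷ʳ y) (F u)) ++ concatMap (map f ∘ joined F) (splits u)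
        ≡⟨ cong (map f (map (_∷ʳ y) (F u)) ++_) (map-concatMap f (joined F) (splits u)) ⟨
      map f (map (_∷ʳ y) (F u)) ++ map f (concatMap (joined F) (splits u))
        ≡⟨ map-++ f (map (_∷ʳ y) (F u)) _ ⟨
      map f (append F u) ∎
      where open ≡-Reasoning

    -- The split of `x ∷ u` with empty left factor contributes nothing, because `shift f F []` is
    -- empty. The other splits are those of `u` with `x` put in front on the left, and `shift`
    -- removes this `x` again.
    append-shift : ∀ F u → append (shift f F) u ≡ shift f (append F) u
    append-shift F []      = refl
    append-shift F (x ∷ u) = trans
      (cong (map (_∷ʳ y) (map f (F u)) ++_)
        (concatMap-map (joined (shift f F)) (map₁ (x ∷_)) (splits u)))
      (append-map F u)

  -- By induction on `u`: `accumulate` is a sum of a shifted copy of itself and `F`, and `append`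
  -- respects both the sum and the shift.
  append-accumulate : ∀ F u → append (accumulate F) u ↭ accumulate (append F) u
  append-accumulate F []      = ↭-refl
  append-accumulate F (x ∷ u) = begin
    append (accumulate F) (x ∷ u)
      ≡⟨ cong (λ ws → map (_∷ʳ y) (accumulate F (x ∷ u)) ++ joined F ([] , u) ++ ws)
           (trans (concatMap-map (joined (accumulate F)) (map₁ (x ∷_)) (splits u))
             (sym (concatMap-map (joined G) (map₁ (x ∷_)) (splits u)))) ⟩
    append G (x ∷ u)
      ↭⟨ append-⊕ (shift (x ∷_) (accumulate F)) F (x ∷ u) ⟩
    append (shift (x ∷_) (accumulate F)) (x ∷ u) ++ append F (x ∷ u)
      ≡⟨ cong (_++ append F (x ∷ u)) (append-shift (λ _ _ → refl) (accumulate F) (x ∷ u)) ⟩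
    map (x ∷_) (append (accumulate F) u) ++ append F (x ∷ u)
      ↭⟨ ++⁺ʳ _ (map⁺ (x ∷_) (append-accumulate F u)) ⟩
    accumulate (append F) (x ∷ u) ∎
    where
    open PermutationReasoning
    -- Agrees with accumulate F on [] and on the words starting with x,
    -- hence on all the words occurring in append (accumulate F) (x ∷ u).
    G : Word → List Word
    G u = shift (x ∷_) (accumulate F) u ++ F u

  concatMap-emptyOnly : ∀ x (ss : List (Word × Word)) →
                        concatMap (joined emptyOnly) (map (map₁ (x ∷_)) ss) ≡ []
  concatMap-emptyOnly x []       = refl
  concatMap-emptyOnly x (_ ∷ ss) = concatMap-emptyOnly x ss

  -- If `u` is empty, the path is a single `𝐔`. Otherwise it is a `𝐃` followed by `𝐑` steps, which
  -- matches the only split that `emptyOnly` lets survive, the one with empty left factor.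
  non𝐑Words-[_] : ∀ u → non𝐑Words [ y ] u ≡ append emptyOnly u
  non𝐑Words-[ []    ] = refl
  non𝐑Words-[ x ∷ u ] = trans
    (cong (map (λ w → y ∷ bar y ∷ w)) (words-[] u))
    (cong ((y ∷ bar y ∷ u) ∷_) (sym (concatMap-emptyOnly x (splits u))))

  -- The induction on `v` is mutual because after a `𝐃` step the rest of the path may start with
  -- `𝐑`.
  non𝐑Words-∷ʳ : ∀ v u → non𝐑Words (v ∷ʳ y) u ↭ append (non𝐑Words v) u
  words-∷ʳ     : ∀ v u → words (v ∷ʳ y) u ↭ append (words v) u

  non𝐑Words-∷ʳ []      u = ↭-reflexive (non𝐑Words-[ u ])
  non𝐑Words-∷ʳ (z ∷ v) u = begin
    map (z ∷_) (non𝐑Words (v ∷ʳ y) u) ++ shift z-bar-z (words (v ∷ʳ y)) u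
      ↭⟨ ++⁺ (map⁺ (z ∷_) (non𝐑Words-∷ʳ v u)) (shift-cong z-bar-z (words-∷ʳ v) u) ⟩
    map (z ∷_) (append (non𝐑Words v) u) ++ shift z-bar-z (append (words v)) u
      ≡⟨ cong₂ _++_ (append-map (λ _ _ → refl) (non𝐑Words v) u)
           (append-shift (λ _ _ → refl) (words v) u) ⟨
    append (map (z ∷_) ∘ non𝐑Words v) u ++ append (shift z-bar-z (words v)) u
      ↭⟨ append-⊕ (map (z ∷_) ∘ non𝐑Words v) (shift z-bar-z (words v)) u ⟨
    append (non𝐑Words (z ∷ v)) u ∎
    where
    open PermutationReasoning
    z-bar-z : Word → Word
    z-bar-z w = z ∷ bar z ∷ w

  words-∷ʳ v u = ↭-trans (accumulate-cong (non𝐑Words-∷ʳ v) u)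
    (↭-sym (append-accumulate (non𝐑Words v) u))

-- Weights of the paths in `Ω`.

non𝐔𝐑? : Decidable (λ (P : Path p q) → ¬ Contains𝐔𝐑 P)
non𝐔𝐑? P = ¬? (contains𝐔𝐑? P)

-- A path P without 𝐔𝐑 does not start with 𝐑 iff 𝐔∷ P has no 𝐔𝐑.
𝐔-non𝐔𝐑? : Decidable (λ (P : Path p q) → ¬ Contains𝐔𝐑 (𝐔∷ P))
𝐔-non𝐔𝐑? P = ¬? (contains𝐔𝐑? (𝐔∷ P))

wtʷ-𝐃 : ∀ x y (u : Vec Letter p) (v : Vec Letter q) (P : Path p q) →
        wtʷ (x ∷ u) (y ∷ v) (𝐃∷ P) ≡ y ∷ bar y ∷ wtʷ u v P
wtʷ-𝐃 x 𝐚 u v P = refl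
wtʷ-𝐃 x 𝐛 u v P = refl

map-filter-++₃ : {P : Pred A 0ℓ} (P? : Decidable P) (f : A → B) (xs ys zs : List A) →
                 map f (filter P? (xs ++ ys ++ zs)) ≡
                 map f (filter P? xs) ++ map f (filter P? ys) ++ map f (filter P? zs)
map-filter-++₃ P? f xs ys zs = begin
  map f (filter P? (xs ++ ys ++ zs))
    ≡⟨ cong (map f) (filter-++ P? xs (ys ++ zs)) ⟩
  map f (filter P? xs ++ filter P? (ys ++ zs))
    ≡⟨ map-++ f (filter P? xs) _ ⟩
  map f (filter P? xs) ++ map f (filter P? (ys ++ zs))
    ≡⟨ cong (λ ws → map f (filter P? xs) ++ map f ws) (filter-++ P? ys zs) ⟩
  map f (filter P? xs) ++ map f (filter P? ys ++ filter P? zs)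
    ≡⟨ cong (map f (filter P? xs) ++_) (map-++ f (filter P? ys) _) ⟩
  map f (filter P? xs) ++ map f (filter P? ys) ++ map f (filter P? zs) ∎
  where open ≡-Reasoning

-- Case split on the first step: what follows a `𝐔` must not start with `𝐑`, what follows an `𝐑` or
-- `𝐃` is only required to avoid `𝐔𝐑`. The cases come in the order of `paths`, so the lists are
-- equal without permutation.
map-wtʷ-Ω : (u : Vec Letter p) (v : Vec Letter q) →
            map (wtʷ u v) (Ω p q) ≡ words (toList v) (toList u)
map-wtʷ-non𝐑 : (u : Vec Letter p) (v : Vec Letter q) →
               map (wtʷ u v) (filter 𝐔-non𝐔𝐑? (paths p q)) ≡ non𝐑Words (toList v) (toList u)

map-wtʷ-Ω []      []      = refl
map-wtʷ-Ω {q = suc q} [] (y ∷ v) = begin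
  map (wtʷ [] (y ∷ v)) (filter non𝐔𝐑? (map 𝐔∷_ (paths 0 q)))
    ≡⟨ map-filter-map non𝐔𝐑? 𝐔-non𝐔𝐑? (λ _ → refl) (λ _ → refl) (paths 0 q) ⟩
  map (y ∷_) (map (wtʷ [] v) (filter 𝐔-non𝐔𝐑? (paths 0 q)))
    ≡⟨ cong (map (y ∷_)) (map-wtʷ-non𝐑 [] v) ⟩
  map (y ∷_) (non𝐑Words (toList v) [])
    ≡⟨ ++-identityʳ _ ⟨
  words (y ∷ toList v) [] ∎
  where open ≡-Reasoning
map-wtʷ-Ω {p = suc p} (x ∷ u) [] = begin
  map (wtʷ (x ∷ u) []) (filter non𝐔𝐑? (map 𝐑∷_ (paths p 0)))
    ≡⟨ map-filter-map non𝐔𝐑? non𝐔𝐑? (λ _ → refl) (λ _ → refl) (paths p 0) ⟩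
  map (x ∷_) (map (wtʷ u []) (Ω p 0))
    ≡⟨ cong (map (x ∷_)) (map-wtʷ-Ω u []) ⟩
  map (x ∷_) (words [] (toList u))
    ≡⟨ ++-identityʳ _ ⟨
  words [] (x ∷ toList u) ∎
  where open ≡-Reasoning
map-wtʷ-Ω {suc p} {suc q} (x ∷ u) (y ∷ v) = begin
  map (wtʷ (x ∷ u) (y ∷ v)) (Ω (suc p) (suc q))
    ≡⟨ map-filter-++₃ non𝐔𝐑? (wtʷ (x ∷ u) (y ∷ v)) (map 𝐑∷_ (paths p (suc q)))
         (map 𝐔∷_ (paths (suc p) q)) (map 𝐃∷_ (paths p q)) ⟩
  _ ≡⟨ cong₂ _++_
         (trans (map-filter-map non𝐔𝐑? non𝐔𝐑? (λ _ → refl) (λ _ → refl) (paths p (suc q)))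
           (cong (map (x ∷_)) (map-wtʷ-Ω u (y ∷ v))))
         (cong₂ _++_
           (trans (map-filter-map non𝐔𝐑? 𝐔-non𝐔𝐑? (λ _ → refl) (λ _ → refl) (paths (suc p) q))
             (cong (map (y ∷_)) (map-wtʷ-non𝐑 (x ∷ u) v)))
           (trans (map-filter-map non𝐔𝐑? non𝐔𝐑? (wtʷ-𝐃 x y u v) (λ _ → refl) (paths p q))
             (cong (map (λ w → y ∷ bar y ∷ w)) (map-wtʷ-Ω u v)))) ⟩
  words (y ∷ toList v) (x ∷ toList u) ∎
  where open ≡-Reasoning

map-wtʷ-non𝐑 []      []      = refl
map-wtʷ-non𝐑 {q = suc q} [] (y ∷ v) = begin
  map (wtʷ [] (y ∷ v)) (filter 𝐔-non𝐔𝐑? (map 𝐔∷_ (paths 0 q)))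
    ≡⟨ map-filter-map 𝐔-non𝐔𝐑? 𝐔-non𝐔𝐑? (λ _ → refl) (λ _ → refl) (paths 0 q) ⟩
  map (y ∷_) (map (wtʷ [] v) (filter 𝐔-non𝐔𝐑? (paths 0 q)))
    ≡⟨ cong (map (y ∷_)) (map-wtʷ-non𝐑 [] v) ⟩
  map (y ∷_) (non𝐑Words (toList v) [])
    ≡⟨ ++-identityʳ _ ⟨
  non𝐑Words (y ∷ toList v) [] ∎
  where open ≡-Reasoning
map-wtʷ-non𝐑 {p = suc p} (x ∷ u) [] =
  -- Every path here starts with `𝐑`, so a `𝐔` in front creates a `𝐔𝐑`.
  cong (map (wtʷ (x ∷ u) [])) (filter-map-none 𝐔-non𝐔𝐑? (λ _ → refl) (paths p 0))
map-wtʷ-non𝐑 {suc p} {suc q} (x ∷ u) (y ∷ v) = begin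
  map (wtʷ (x ∷ u) (y ∷ v)) (filter 𝐔-non𝐔𝐑? (paths (suc p) (suc q)))
    ≡⟨ map-filter-++₃ 𝐔-non𝐔𝐑? (wtʷ (x ∷ u) (y ∷ v)) (map 𝐑∷_ (paths p (suc q)))
         (map 𝐔∷_ (paths (suc p) q)) (map 𝐃∷_ (paths p q)) ⟩
  _ ≡⟨ cong₂ _++_
         (cong (map (wtʷ (x ∷ u) (y ∷ v)))
           (filter-map-none 𝐔-non𝐔𝐑? (λ _ → refl) (paths p (suc q))))
         (cong₂ _++_
           (trans (map-filter-map 𝐔-non𝐔𝐑? 𝐔-non𝐔𝐑? (λ _ → refl) (λ _ → refl) (paths (suc p) q))
             (cong (map (y ∷_)) (map-wtʷ-non𝐑 (x ∷ u) v)))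
           (trans (map-filter-map 𝐔-non𝐔𝐑? non𝐔𝐑? (wtʷ-𝐃 x y u v) (λ _ → refl) (paths p q))
             (cong (map (λ w → y ∷ bar y ∷ w)) (map-wtʷ-Ω u v)))) ⟩
  non𝐑Words (y ∷ toList v) (x ∷ toList u) ∎
  where open ≡-Reasoning

-- Lists of words as polynomials.

⟦_⟧ : List A → Free A
⟦_⟧ = map (1ℤ ,_)

concatMap-⟨⟩ : (f : A → B) (xs : List A) → (∑[ x ← xs ] ⟨ f x ⟩) ≡ ⟦ map f xs ⟧
concatMap-⟨⟩ f []       = refl
concatMap-⟨⟩ f (x ∷ xs) = cong (_ ∷_) (concatMap-⟨⟩ f xs)

-- Coefficients are literally `1ℤ` and their products compute, so this holds as an equality of
-- lists.
1•⟦_⟧ : (xs : List A) → 1ℤ • ⟦ xs ⟧ ≡ ⟦ xs ⟧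
1•⟦ []     ⟧ = refl
1•⟦ x ∷ xs ⟧ = cong (_ ∷_) 1•⟦ xs ⟧

extend-⟦⟧ : (f : A → List B) (xs : List A) →
            (extend[ x ← ⟦ xs ⟧ ] ⟦ f x ⟧) ≡ ⟦ concatMap f xs ⟧
extend-⟦⟧ f []       = refl
extend-⟦⟧ f (x ∷ xs) = trans (cong₂ _++_ 1•⟦ f x ⟧ (extend-⟦⟧ f xs)) (sym (map-++ _ (f x) _))

⟦⟧-·-⟨⟩ : ∀ ws t → ⟦ ws ⟧ · ⟨ t ⟩ ≡ ⟦ map (_++ t) ws ⟧
⟦⟧-·-⟨⟩ []       t = refl
⟦⟧-·-⟨⟩ (w ∷ ws) t = cong (_ ∷_) (⟦⟧-·-⟨⟩ ws t)

⟦⟧-resp-↭ : ⦃ _ : DecEq A ⦄ {xs ys : List A} → xs ↭ ys → ⟦ xs ⟧ ≈ ⟦ ys ⟧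
⟦⟧-resp-↭ ↭-refl          = ≈-refl
⟦⟧-resp-↭ (prep x r)      = +-cong {f = ⟨ x ⟩} ≈-refl (⟦⟧-resp-↭ r)
⟦⟧-resp-↭ (swap {xs = xs} x y r) = ≈-trans
  -- Coefficientwise the exchange of two terms is a + (b + s) = b + (a + s).
  (mk≈ λ z → trans (sym (ℤₚ.+-assoc (term z _) (term z _) _))
    (trans (cong (ℤ._+ coeff ⟦ xs ⟧ z) (ℤₚ.+-comm (term z _) (term z _)))
      (ℤₚ.+-assoc (term z _) (term z _) _)))
  (+-cong {f = ⟨ y ⟩ + ⟨ x ⟩} ≈-refl (⟦⟧-resp-↭ r))
⟦⟧-resp-↭ (↭-trans r s)   = ≈-trans (⟦⟧-resp-↭ r) (⟦⟧-resp-↭ s)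

Δʷ≡⟦splits⟧ : ∀ u → Δʷ u ≡ ⟦ splits u ⟧
Δʷ≡⟦splits⟧ u = trans (concatMap-⟨⟩ _ (upTo (length u)))
  (cong ⟦_⟧ (trans (map-upTo _ (length u)) (sym (splits≡applyUpTo u))))

⟦⟧-tail : ∀ y ws t → ⟦ ws ⟧ · var y · var (bar y) · ⟨ t ⟩ ≡ ⟦ map (_++ y ∷ bar y ∷ t) ws ⟧
⟦⟧-tail y []       t = refl
⟦⟧-tail y (w ∷ ws) t = cong₂ _∷_
  (cong (1ℤ ,_) (trans (++-assoc (w ++ [ y ]) [ bar y ] t) (++-assoc w [ y ] (bar y ∷ t))))
  (⟦⟧-tail y ws t)

-- The diamond product of two monomials.

module _ (_⋄_ : Poly → Poly → Poly) (isDiamond : IsDiamondProduct _⋄_) where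
  open IsDiamondProduct isDiamond

  ⋄-var : ∀ y u v → u ⋄ (v · var y) ≈
          (u ⋄ v) · var y
          + (extend[ (u₁ , u₂) ← Δ u ] (⟨ u₁ ⟩ ⋄ v) · var y · var (bar y) · ⟨ u₂ ⟩)
  ⋄-var 𝐚 = ⋄-𝐚
  ⋄-var 𝐛 = ⋄-𝐛

  ·-congˡ : ∀ {f g} h → f ≈ g → f · h ≈ g · h
  ·-congˡ h = ·-bilinear .linearˡ h .resp-≈

  -- The defining equations remove the last letter of `v`, hence the induction along `Reverse v`.
  -- The word `u` stays general, since the Sweedler sum needs the hypothesis at every left factor
  -- `u₁`.
  ⟨⟩⋄⟨⟩ : ∀ {v} → Reverse v → ∀ u → ⟨ u ⟩ ⋄ ⟨ v ⟩ ≈ ⟦ words v u ⟧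
  ⟨⟩⋄⟨⟩ [] u = ≈-trans (⋄-𝟏 ⟨ u ⟩) (≈-reflexive (cong ⟦_⟧ (sym (words-[] u))))
  ⟨⟩⋄⟨⟩ (v ∶ rs ∶ʳ y) u = begin
    ⟨ u ⟩ ⋄ ⟨ v ∷ʳ y ⟩
      ≈⟨ bilinear .linearʳ ⟨ u ⟩ .resp-≈ (≈-sym (⟨⟩-· v [ y ])) ⟩
    ⟨ u ⟩ ⋄ (⟨ v ⟩ · var y)
      ≈⟨ ⋄-var y ⟨ u ⟩ ⟨ v ⟩ ⟩
    (⟨ u ⟩ ⋄ ⟨ v ⟩) · var y
    + (extend[ (u₁ , u₂) ← Δ ⟨ u ⟩ ] (⟨ u₁ ⟩ ⋄ ⟨ v ⟩) · var y · var (bar y) · ⟨ u₂ ⟩)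
      ≈⟨ +-cong (·-congˡ (var y) (⟨⟩⋄⟨⟩ rs u)) (≈-trans
           -- The sum is linear in `Δ ⟨ u ⟩`, which may thus be replaced by the list of splits
           -- before the hypothesis is applied term by term.
           (extend-linear _ .resp-≈
             (≈-trans (extend-⟨⟩ Δʷ u) (≈-reflexive (Δʷ≡⟦splits⟧ u))))
           (extend-cong ⟦ splits u ⟧ λ (u₁ , u₂) → ≈-trans
             (·-congˡ ⟨ u₂ ⟩ (·-congˡ (var (bar y)) (·-congˡ (var y) (⟨⟩⋄⟨⟩ rs u₁))))
             (≈-reflexive (⟦⟧-tail y (words v u₁) u₂)))) ⟩
    ⟦ words v u ⟧ · var y + (extend[ s ← ⟦ splits u ⟧ ] ⟦ joined y (words v) s ⟧)
      ≡⟨ cong₂ _+_ (⟦⟧-·-⟨⟩ (words v u) [ y ]) (extend-⟦⟧ (joined y (words v)) (splits u)) ⟩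
    ⟦ map (_∷ʳ y) (words v u) ⟧ + ⟦ concatMap (joined y (words v)) (splits u) ⟧
      ≡⟨ map-++ (1ℤ ,_) (map (_∷ʳ y) (words v u)) _ ⟨
    ⟦ append y (words v) u ⟧
      ≈⟨ ⟦⟧-resp-↭ (words-∷ʳ y v u) ⟨
    ⟦ words (v ∷ʳ y) u ⟧ ∎
    where open SetoidReasoning (≈-setoid Word)

theorem4p2 : (_⋄_ : Poly → Poly → Poly) → IsDiamondProduct _⋄_ →
    ∀ {p q : ℕ} (u : Vec Letter p) (v : Vec Letter q) →
    monomial u ⋄ monomial v ≈ ∑[ P ← Ω p q ] wt u v P
theorem4p2 _⋄_ isDiamond {p} {q} u v = begin
  monomial u ⋄ monomial v           ≈⟨ ⟨⟩⋄⟨⟩ _⋄_ isDiamond (reverseView (toList v)) (toList u) ⟩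
  ⟦ words (toList v) (toList u) ⟧   ≡⟨ cong ⟦_⟧ (map-wtʷ-Ω u v) ⟨
  ⟦ map (wtʷ u v) (Ω p q) ⟧         ≡⟨ concatMap-⟨⟩ (wtʷ u v) (Ω p q) ⟨
  (∑[ P ← Ω p q ] wt u v P)         ∎
  where open SetoidReasoning (≈-setoid Word)
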